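{- Wilf's conjecture is asymptotically true as the genus goes to infinity: for $g\ge 1$, let $n_g$ be the number of numerical semigroups of genus $g$ and let $w_g$ be the number of numerical semigroups $S$ of genus $g$ satisfying $e(S)\,|L(S)|\ge c(S)$. Then $\lim_{g\to\infty} w_g/n_g=1$.
   Context: $\mathbb{N}=\{0,1,2,\dots\}$. A numerical semigroup is a subset $S\subseteq\mathbb{N}$ closed under addition, containing $0$, with finite complement in $\mathbb{N}$. Its genus is $g(S)=|\mathbb{N}\setminus S|$ (for each $g$ there are finitely many numerical semigroups of genus $g$); its conductor is $c(S)=\max(\mathbb{N}\setminus S)+1$; $L(S)=\{s\in S : s<c(S)\}$; its embedding dimension $e(S)$ is the least number of elements generating $S$ as a semigroup (additive monoid). -}

module Defs where

open import Data.List.Base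
  using (List; []; _∷_; _++_; length; map; filter; upTo; deduplicate)
open import Data.List.Extrema.Nat using (max; v≤max⁺; max≤v⁺; xs≤max)
open import Data.List.Membership.Propositional using (_∈_; _∉_; lose)
open import Data.List.Membership.Propositional.Properties
  using (∈-∃++; ∈-++⁺ˡ; ∈-++⁺ʳ; ∈-++⁻; ∈-map⁺; ∈-map⁻; ∈-filter⁺; ∈-filter⁻; ∈-upTo⁺; ∈-upTo⁻)
import Data.List.Membership.Setoid as SetoidMembership
import Data.List.Membership.Setoid.Properties as SetoidMembershipₚ
open import Data.List.Properties using (length-++; length-map; length-upTo; filter-≐)
open import Data.List.Relation.Unary.All as All using (All; all?)
import Data.List.Relation.Unary.All.Properties as Allₚ
open import Data.List.Relation.Unary.AllPairs using (_∷_)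
open import Data.List.Relation.Unary.Any as Any using (Any; here; there)
open import Data.List.Relation.Unary.Unique.Propositional using (Unique)
import Data.List.Relation.Unary.Unique.Propositional.Properties as Uniqueₚ
import Data.List.Relation.Unary.Unique.Setoid as SetoidUnique
import Data.List.Relation.Unary.Unique.Setoid.Properties as SetoidUniqueₚ
import Data.List.Relation.Unary.Unique.DecSetoid.Properties as DecSetoidUniqueₚ
open import Data.Nat.Base
  using (ℕ; zero; suc; _+_; _*_; _∸_; _≤_; _<_; z≤n; s≤s; s≤s⁻¹; z<s; NonZero)
open import Data.Nat.Induction using (<-rec)
open import Data.Nat.Properties
open import Data.List.Membership.DecPropositional _≟_ using (_∈?_)
open import Data.List.Relation.Unary.Unique.DecPropositional _≟_ using (unique?)
open import Data.Product.Base using (∃-syntax; _×_; _,_; proj₁; proj₂)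
open import Data.Rational.Base as ℚ using (ℚ; 0ℚ)
open import Data.Sum.Base using (_⊎_; inj₁; inj₂; [_,_]′)
open import Function.Base using (_∘_)
open import Function.Bundles using (_⇔_; mk⇔; Equivalence)
open import Level using (Level; 0ℓ; _⊔_) renaming (suc to lsuc)
open import Relation.Binary.Bundles using (Setoid; DecSetoid)
import Relation.Binary.Construct.On as On
open import Relation.Binary.PropositionalEquality
  using (_≡_; _≢_; refl; sym; trans; cong; cong₂; subst; subst₂)
import Relation.Binary.PropositionalEquality.Properties as ≡
open import Relation.Nullary using (¬_; Dec; yes; no; ¬?; contradiction)
open import Relation.Nullary.Decidable using (_×-dec_; _⊎-dec_; map′; decidable-stable)
open import Relation.Unary using (Pred; Decidable; ∁; _≐_)
open import Relation.Unary.Relation.Binary.Equality using (≐-setoid)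

record Finite {a ℓ p : Level} (A : Setoid a ℓ) (P : Pred (Setoid.Carrier A) p)
              : Set (a ⊔ ℓ ⊔ p) where
  open SetoidMembership A using () renaming (_∈_ to _∈ₛ_)
  field
    elements : List (Setoid.Carrier A)
    unique   : SetoidUnique.Unique A elements
    complete : ∀ x → x ∈ₛ elements ⇔ P x

  card : ℕ
  card = length elements

unique-⊆⇒length≤ : ∀ {xs ys : List ℕ} → Unique xs →
                   (∀ {x} → x ∈ xs → x ∈ ys) → length xs ≤ length ys
unique-⊆⇒length≤ {[]} _ _ = z≤n
unique-⊆⇒length≤ {x ∷ xs} {ys} (x∉xs ∷ u) sub with ∈-∃++ (sub (here refl))
... | as , bs , refl = begin
  suc (length xs)               ≤⟨ s≤s (unique-⊆⇒length≤ u sub′) ⟩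
  suc (length (as ++ bs))       ≡⟨ cong suc (length-++ as) ⟩
  suc (length as + length bs)   ≡⟨ sym (+-suc (length as) (length bs)) ⟩
  length as + suc (length bs)   ≡⟨ sym (length-++ as) ⟩
  length (as ++ x ∷ bs)         ∎
  where
  open ≤-Reasoning
  sub′ : ∀ {y} → y ∈ xs → y ∈ as ++ bs
  sub′ y∈xs with ∈-++⁻ as (sub (there y∈xs))
  ... | inj₁ y∈as         = ∈-++⁺ˡ y∈as
  ... | inj₂ (here refl)  = contradiction refl (All.lookup x∉xs y∈xs)
  ... | inj₂ (there y∈bs) = ∈-++⁺ʳ as y∈bs

-- Every cofinite subset of ℕ is classically decidable, so the field
-- `member?` is no restriction.
record NumericalSemigroup : Set₁ where
  field
    Member   : Pred ℕ 0ℓ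
    member?  : Decidable Member
    0∈       : Member 0
    +-closed : ∀ {x y} → Member x → Member y → Member (x + y)
    cofinite : Finite (≡.setoid ℕ) (∁ Member)

  gaps : List ℕ
  gaps = Finite.elements cofinite

  genus : ℕ
  genus = Finite.card cofinite

  -- One plus the largest gap; the value for the semigroup ℕ, which has no
  -- gaps, is 0.
  conductor : ℕ
  conductor = max 0 (map suc gaps)

  L : List ℕ
  L = filter member? (upTo conductor)

  gap⁺ : ∀ {x} → ¬ Member x → x ∈ gaps
  gap⁺ {x} = Equivalence.from (Finite.complete cofinite x)

  gap⁻ : ∀ {x} → x ∈ gaps → ¬ Member x
  gap⁻ {x} = Equivalence.to (Finite.complete cofinite x)

  ≥conductor⇒member : ∀ {x} → conductor ≤ x → Member x
  ≥conductor⇒member {x} c≤x = decidable-stable (member? x) λ x∉S →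
    <⇒≱ (v≤max⁺ 0 (map suc gaps) (inj₂ (lose (∈-map⁺ suc (gap⁺ x∉S)) ≤-refl))) c≤x

  gap<2genus : ∀ {x} → x ∈ gaps → x < genus + genus
  gap<2genus {x} x∈gaps = begin
    suc x                               ≡⟨ sym (length-upTo (suc x)) ⟩
    length (upTo (suc x))               ≤⟨ unique-⊆⇒length≤ (Uniqueₚ.upTo⁺ (suc x)) covered ⟩
    length (gaps ++ map (x ∸_) gaps)    ≡⟨ length-++ gaps ⟩
    genus + length (map (x ∸_) gaps)    ≡⟨ cong (genus +_) (length-map (x ∸_) gaps) ⟩
    genus + genus                       ∎
    where
    open ≤-Reasoning
    covered : ∀ {i} → i ∈ upTo (suc x) → i ∈ gaps ++ map (x ∸_) gaps
    covered {i} i∈ with s≤s i≤x ← ∈-upTo⁻ i∈ | member? i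
    ... | no  i∉S = ∈-++⁺ˡ (gap⁺ i∉S)
    ... | yes i∈S = ∈-++⁺ʳ gaps (subst (_∈ map (x ∸_) gaps) (m∸[m∸n]≡n i≤x)
            (∈-map⁺ (x ∸_) (gap⁺ λ x∸i∈S →
              gap⁻ x∈gaps (subst Member (m+[n∸m]≡n i≤x) (+-closed i∈S x∸i∈S)))))

open NumericalSemigroup
  using (Member; member?; 0∈; +-closed; gaps; genus; conductor; L; gap⁺; gap⁻)

NumericalSemigroup-setoid : Setoid (lsuc 0ℓ) 0ℓ
NumericalSemigroup-setoid = On.setoid (≐-setoid ℕ 0ℓ) Member

open Setoid NumericalSemigroup-setoid public using (_≈_)
  renaming (sym to ≈-sym)

gaps-⊆ : ∀ {S T} → S ≈ T → ∀ {x} → x ∈ gaps S → x ∈ gaps T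
gaps-⊆ {S} {T} (_ , T⊆S) x∈ = gap⁺ T (gap⁻ S x∈ ∘ T⊆S)

gaps-⊇⇒⊆ : ∀ S T → (∀ {x} → x ∈ gaps T → x ∈ gaps S) → ∀ {x} → Member S x → Member T x
gaps-⊇⇒⊆ S T sub {x} x∈S =
  decidable-stable (member? T x) λ x∉T → gap⁻ S (sub (gap⁺ T x∉T)) x∈S

_≈?_ : ∀ S T → Dec (S ≈ T)
S ≈? T = map′
  (λ (p , q) → gaps-⊇⇒⊆ S T (All.lookup q) , gaps-⊇⇒⊆ T S (All.lookup p))
  (λ eq → All.tabulate (gaps-⊆ {S} {T} eq) ,
          All.tabulate (gaps-⊆ {T} {S} (≈-sym {S} {T} eq)))
  (all? (_∈? gaps T) (gaps S) ×-dec all? (_∈? gaps S) (gaps T))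

NumericalSemigroup-decSetoid : DecSetoid (lsuc 0ℓ) 0ℓ
NumericalSemigroup-decSetoid = record
  { isDecEquivalence = record
    { isEquivalence = Setoid.isEquivalence NumericalSemigroup-setoid
    ; _≟_           = _≈?_
    }
  }

-- The submonoid of (ℕ, +) generated by the entries of a list.
data ⟨_⟩ (xs : List ℕ) : Pred ℕ 0ℓ where
  unit : ⟨ xs ⟩ 0
  gen  : ∀ {x} → x ∈ xs → ⟨ xs ⟩ x
  add  : ∀ {x y} → ⟨ xs ⟩ x → ⟨ xs ⟩ y → ⟨ xs ⟩ (x + y)

GeneratedBy : NumericalSemigroup → Pred ℕ 0ℓ
GeneratedBy S k = ∃[ xs ] length xs ≡ k × ⟨ xs ⟩ ≐ Member S

IsLeast : Pred ℕ 0ℓ → Pred ℕ 0ℓ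
IsLeast P k = P k × (∀ j → P j → k ≤ j)

-- The existence of a least size of a generating set is witnessed by the
-- nonzero elements that are not sums of two nonzero elements.
module Atoms (S : NumericalSemigroup) where

  Splits : Pred ℕ 0ℓ
  Splits s = ∃[ x ] x < s × x ≢ 0 × Member S x × Member S (s ∸ x)

  Atom : Pred ℕ 0ℓ
  Atom s = Member S s × s ≢ 0 × ¬ Splits s

  splits? : Decidable Splits
  splits? s = anyUpTo? (λ x → ¬? (x ≟ 0) ×-dec member? S x ×-dec member? S (s ∸ x)) s

  atom? : Decidable Atom
  atom? s = member? S s ×-dec ¬? (s ≟ 0) ×-dec ¬? (splits? s)

  bound : ℕ
  bound = suc (conductor S) + suc (conductor S)

  atom<bound : ∀ {s} → Atom s → s < bound
  atom<bound {s} (_ , _ , ¬split) = ≰⇒> λ b≤s → ¬split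
    ( suc (conductor S)
    , <-≤-trans (m<m+n (suc (conductor S)) z<s) b≤s
    , (λ ())
    , NumericalSemigroup.≥conductor⇒member S (n≤1+n _)
    , NumericalSemigroup.≥conductor⇒member S
        (≤-trans (n≤1+n _) (m+n≤o⇒m≤o∸n (suc (conductor S)) b≤s)) )

  atoms : List ℕ
  atoms = filter atom? (upTo bound)

  atoms-generate : ∀ s → Member S s → ⟨ atoms ⟩ s
  atoms-generate = <-rec _ step
    where
    step : ∀ s → (∀ {t} → t < s → Member S t → ⟨ atoms ⟩ t) → Member S s → ⟨ atoms ⟩ s
    step s ih s∈S with s ≟ 0 | splits? s
    ... | yes refl | _ = unit
    ... | no s≢0 | no ¬split =
      gen (∈-filter⁺ atom? (∈-upTo⁺ (atom<bound atom)) atom)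
      where
      atom : Atom s
      atom = s∈S , s≢0 , ¬split
    ... | no s≢0 | yes (x , x<s , x≢0 , x∈S , s∸x∈S) =
      subst ⟨ atoms ⟩ (m+[n∸m]≡n (<⇒≤ x<s))
        (add (ih x<s x∈S) (ih (∸-monoʳ-< (n≢0⇒n>0 x≢0) (<⇒≤ x<s)) s∸x∈S))

  generated⊆S : ∀ {x} → ⟨ atoms ⟩ x → Member S x
  generated⊆S unit      = 0∈ S
  generated⊆S (gen x∈)  = proj₁ (proj₂ (∈-filter⁻ atom? {xs = upTo bound} x∈))
  generated⊆S (add p q) = +-closed S (generated⊆S p) (generated⊆S q)

  atom-∈ : ∀ {xs} → ⟨ xs ⟩ ≐ Member S → ∀ {s} → ⟨ xs ⟩ s → Atom s → s ∈ xs
  atom-∈ gS unit     (_ , 0≢0 , _) = contradiction refl 0≢0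
  atom-∈ gS (gen x∈) _             = x∈
  atom-∈ gS (add {zero}  {y} p q) a = atom-∈ gS q a
  atom-∈ {xs} gS (add {suc x} {zero} p q) a =
    subst (_∈ xs) (sym (+-identityʳ _))
      (atom-∈ gS p (subst Atom (+-identityʳ _) a))
  atom-∈ gS (add {suc x} {suc y} p q) (_ , _ , ¬split) = contradiction
    ( suc x , m<m+n (suc x) z<s , (λ ()) , proj₁ gS p
    , subst (Member S) (sym (m+n∸m≡n (suc x) (suc y))) (proj₁ gS q) )
    ¬split

  isLeast : IsLeast (GeneratedBy S) (length atoms)
  isLeast = (atoms , refl , generated⊆S , λ {s} → atoms-generate s) , least
    where
    least : ∀ j → GeneratedBy S j → length atoms ≤ j
    least _ (xs , refl , gS) =
      unique-⊆⇒length≤ (Uniqueₚ.filter⁺ atom? (Uniqueₚ.upTo⁺ bound)) λ x∈ →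
        let a = proj₂ (∈-filter⁻ atom? {xs = upTo bound} x∈)
        in atom-∈ gS (proj₂ gS (proj₁ a)) a

leastGeneratedBy : ∀ S → ∃[ k ] IsLeast (GeneratedBy S) k
leastGeneratedBy S = length (Atoms.atoms S) , Atoms.isLeast S

embeddingDimension : NumericalSemigroup → ℕ
embeddingDimension S = proj₁ (leastGeneratedBy S)

Wilf : Pred NumericalSemigroup 0ℓ
Wilf S = conductor S ≤ embeddingDimension S * length (L S)

genus-mono : ∀ {S T} → S ≈ T → genus S ≤ genus T
genus-mono {S} {T} eq =
  unique-⊆⇒length≤ (Finite.unique (NumericalSemigroup.cofinite S)) (gaps-⊆ {S} {T} eq)

genus-cong : ∀ {S T} → S ≈ T → genus S ≡ genus T
genus-cong {S} {T} eq =
  ≤-antisym (genus-mono {S} {T} eq) (genus-mono {T} {S} (≈-sym {S} {T} eq))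

conductor-mono : ∀ {S T} → S ≈ T → conductor S ≤ conductor T
conductor-mono {S} {T} eq = max≤v⁺ z≤n (Allₚ.map⁺ (All.tabulate λ x∈ →
  All.lookup (xs≤max 0 (map suc (gaps T))) (∈-map⁺ suc (gaps-⊆ {S} {T} eq x∈))))

conductor-cong : ∀ {S T} → S ≈ T → conductor S ≡ conductor T
conductor-cong {S} {T} eq =
  ≤-antisym (conductor-mono {S} {T} eq) (conductor-mono {T} {S} (≈-sym {S} {T} eq))

L-cong : ∀ {S T} → S ≈ T → L S ≡ L T
L-cong {S} {T} eq = trans (filter-≐ (member? S) (member? T) eq (upTo (conductor S)))
  (cong (filter (member? T) ∘ upTo) (conductor-cong {S} {T} eq))

embeddingDimension-mono : ∀ {S T} → S ≈ T → embeddingDimension S ≤ embeddingDimension T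
embeddingDimension-mono {S} {T} (S⊆T , T⊆S)
  with (xs , len , g⊆T , T⊆g) , _ ← proj₂ (leastGeneratedBy T) =
  proj₂ (proj₂ (leastGeneratedBy S)) _ (xs , len , T⊆S ∘ g⊆T , T⊆g ∘ S⊆T)

embeddingDimension-cong : ∀ {S T} → S ≈ T → embeddingDimension S ≡ embeddingDimension T
embeddingDimension-cong {S} {T} eq =
  ≤-antisym (embeddingDimension-mono {S} {T} eq)
            (embeddingDimension-mono {T} {S} (≈-sym {S} {T} eq))

Wilf-resp : ∀ {S T} → S ≈ T → Wilf S → Wilf T
Wilf-resp {S} {T} eq = subst₂ _≤_ (conductor-cong {S} {T} eq)
  (cong₂ _*_ (embeddingDimension-cong {S} {T} eq) (cong length (L-cong {S} {T} eq)))

sublists : List ℕ → List (List ℕ)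
sublists []       = [] ∷ []
sublists (x ∷ xs) = map (x ∷_) (sublists xs) ++ sublists xs

filter-∈-sublists : ∀ {P : Pred ℕ 0ℓ} (P? : Decidable P) xs → filter P? xs ∈ sublists xs
filter-∈-sublists P? [] = here refl
filter-∈-sublists P? (x ∷ xs) with P? x
... | yes _ = ∈-++⁺ˡ (∈-map⁺ (x ∷_) (filter-∈-sublists P? xs))
... | no  _ = ∈-++⁺ʳ (map (x ∷_) (sublists xs)) (filter-∈-sublists P? xs)

IsGapSet : Pred (List ℕ) 0ℓ
IsGapSet l = Unique l × 0 ∉ l ×
  All (λ z → All (λ x → x ∈ l ⊎ z ∸ x ∈ l) (upTo (suc z))) l

isGapSet? : Decidable IsGapSet
isGapSet? l = unique? l ×-dec ¬? (0 ∈? l) ×-dec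
  all? (λ z → all? (λ x → (x ∈? l) ⊎-dec ((z ∸ x) ∈? l)) (upTo (suc z))) l

fromGaps : ∀ l → IsGapSet l → NumericalSemigroup
fromGaps l (u , 0∉l , closed) = record
  { Member   = _∉ l
  ; member?  = λ x → ¬? (x ∈? l)
  ; 0∈       = 0∉l
  ; +-closed = λ {x} {y} x∉l y∉l x+y∈l →
      [ x∉l , y∉l ∘ subst (_∈ l) (m+n∸m≡n x y) ]′
        (All.lookup (All.lookup closed x+y∈l) (∈-upTo⁺ (s≤s (m≤m+n x y))))
  ; cofinite = record
      { elements = l
      ; unique   = u
      ; complete = λ x → mk⇔ (λ x∈l x∉l → x∉l x∈l) (decidable-stable (x ∈? l))
      }
  }

gapSets→semigroups : List (List ℕ) → List NumericalSemigroup
gapSets→semigroups [] = []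
gapSets→semigroups (l ∷ ls) with isGapSet? l
... | yes p = fromGaps l p ∷ gapSets→semigroups ls
... | no  _ = gapSets→semigroups ls

gapSets→semigroups⁺ : ∀ {l ls} → l ∈ ls → IsGapSet l →
                      Any (λ T → gaps T ≡ l) (gapSets→semigroups ls)
gapSets→semigroups⁺ {l} (here refl) p with isGapSet? l
... | yes _ = here refl
... | no ¬p = contradiction p ¬p
gapSets→semigroups⁺ {ls = m ∷ _} (there l∈) p with isGapSet? m
... | yes _ = there (gapSets→semigroups⁺ l∈ p)
... | no  _ = gapSets→semigroups⁺ l∈ p

module GenusFinite (g : ℕ) where

  open SetoidMembership NumericalSemigroup-setoid using () renaming (_∈_ to _∈ₛ_)

  candidates : List NumericalSemigroup
  candidates = gapSets→semigroups (sublists (upTo (g + g)))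

  genus? : Decidable (λ S → genus S ≡ g)
  genus? S = genus S ≟ g

  semigroups : List NumericalSemigroup
  semigroups = filter genus? (deduplicate _≈?_ candidates)

  candidates-complete : ∀ S → genus S ≡ g → S ∈ₛ candidates
  candidates-complete S refl =
    Any.map (λ {T} → same T)
      (gapSets→semigroups⁺ (filter-∈-sublists gap? (upTo (g + g))) isGapSet)
    where
    gap? : Decidable (∁ (Member S))
    gap? x = ¬? (member? S x)

    l : List ℕ
    l = filter gap? (upTo (g + g))

    l⊆gaps : ∀ {x} → x ∈ l → x ∈ gaps S
    l⊆gaps x∈l = gap⁺ S (proj₂ (∈-filter⁻ gap? {xs = upTo (g + g)} x∈l))

    gaps⊆l : ∀ {x} → x ∈ gaps S → x ∈ l
    gaps⊆l x∈ =
      ∈-filter⁺ gap? (∈-upTo⁺ (NumericalSemigroup.gap<2genus S x∈)) (gap⁻ S x∈)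

    same : ∀ T → gaps T ≡ l → S ≈ T
    same T eq = gaps-⊇⇒⊆ S T (λ {x} → l⊆gaps ∘ subst (x ∈_) eq)
              , gaps-⊇⇒⊆ T S (λ {x} → subst (x ∈_) (sym eq) ∘ gaps⊆l)

    isGapSet : IsGapSet l
    isGapSet = Uniqueₚ.filter⁺ gap? (Uniqueₚ.upTo⁺ (g + g))
             , (λ 0∈l → gap⁻ S (l⊆gaps 0∈l) (0∈ S))
             , All.tabulate λ z∈l → All.tabulate λ x∈ → split z∈l (s≤s⁻¹ (∈-upTo⁻ x∈))
      where
      split : ∀ {z x} → z ∈ l → x ≤ z → x ∈ l ⊎ z ∸ x ∈ l
      split {z} {x} z∈l x≤z with member? S x
      ... | no  x∉S = inj₁ (gaps⊆l (gap⁺ S x∉S))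
      ... | yes x∈S = inj₂ (gaps⊆l (gap⁺ S λ z∸x∈S →
              gap⁻ S (l⊆gaps z∈l)
                (subst (Member S) (m+[n∸m]≡n x≤z) (+-closed S x∈S z∸x∈S))))

  finite : Finite NumericalSemigroup-setoid (λ S → genus S ≡ g)
  finite = record
    { elements = semigroups
    ; unique   = SetoidUniqueₚ.filter⁺ NumericalSemigroup-setoid genus?
                   (DecSetoidUniqueₚ.deduplicate-! NumericalSemigroup-decSetoid candidates)
    ; complete = λ S → mk⇔ (sound S) (exhaustive S)
    }
    where
    genus-resp : ∀ {S T} → S ≈ T → genus S ≡ g → genus T ≡ g
    genus-resp {S} {T} eq = trans (sym (genus-cong {S} {T} eq))

    dedup-resp : ∀ {A B C} → C ≈ B → A ≈ B → A ≈ C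
    dedup-resp {A} {B} {C} p q =
      Setoid.trans NumericalSemigroup-setoid {A} {B} {C} q (≈-sym {C} {B} p)

    sound : ∀ S → S ∈ₛ semigroups → genus S ≡ g
    sound S S∈ = proj₂ (SetoidMembershipₚ.∈-filter⁻ NumericalSemigroup-setoid genus?
      (λ {A} {B} → genus-resp {A} {B}) {v = S} {xs = deduplicate _≈?_ candidates} S∈)

    exhaustive : ∀ S → genus S ≡ g → S ∈ₛ semigroups
    exhaustive S eq = SetoidMembershipₚ.∈-filter⁺ NumericalSemigroup-setoid genus?
      (λ {A} {B} → genus-resp {A} {B}) {v = S}
      (SetoidMembershipₚ.∈-deduplicate⁺ NumericalSemigroup-setoid _≈?_
        (λ {A} {B} {C} → dedup-resp {A} {B} {C}) {z = S} (candidates-complete S eq))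
      eq

  wilfFinite : Finite NumericalSemigroup-setoid (λ S → genus S ≡ g × Wilf S)
  wilfFinite = record
    { elements = filter Wilf? semigroups
    ; unique   = SetoidUniqueₚ.filter⁺ NumericalSemigroup-setoid Wilf? (Finite.unique finite)
    ; complete = λ S → mk⇔ (sound S) (λ (eq , W) → exhaustive S eq W)
    }
    where
    Wilf? : Decidable Wilf
    Wilf? S = conductor S ≤? embeddingDimension S * length (L S)

    sound : ∀ S → S ∈ₛ filter Wilf? semigroups → genus S ≡ g × Wilf S
    sound S S∈ with S∈′ , W ← SetoidMembershipₚ.∈-filter⁻ NumericalSemigroup-setoid Wilf?
                     (λ {A} {B} → Wilf-resp {A} {B}) {v = S} {xs = semigroups} S∈ =
      Equivalence.to (Finite.complete finite S) S∈′ , W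

    exhaustive : ∀ S → genus S ≡ g → Wilf S → S ∈ₛ filter Wilf? semigroups
    exhaustive S eq = SetoidMembershipₚ.∈-filter⁺ NumericalSemigroup-setoid Wilf?
      (λ {A} {B} → Wilf-resp {A} {B}) {v = S}
      (Equivalence.from (Finite.complete finite S) eq)

n : ℕ → ℕ
n g = Finite.card (GenusFinite.finite g)

w : ℕ → ℕ
w g = Finite.card (GenusFinite.wilfFinite g)

-- {0} ∪ {g+1, g+2, …} has genus g.
ordinary : ℕ → NumericalSemigroup
ordinary g = fromGaps l
  ( Uniqueₚ.map⁺ suc-injective (Uniqueₚ.upTo⁺ g)
  , (λ 0∈l → case0 (∈-map⁻ suc 0∈l))
  , All.tabulate λ z∈l → All.tabulate λ x∈ → split z∈l (s≤s⁻¹ (∈-upTo⁻ x∈)) )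
  where
  l : List ℕ
  l = map suc (upTo g)

  case0 : ¬ (∃[ y ] y ∈ upTo g × 0 ≡ suc y)
  case0 ()

  split : ∀ {z x} → z ∈ l → x ≤ z → x ∈ l ⊎ z ∸ x ∈ l
  split {x = zero}  z∈l _ = inj₂ z∈l
  split {x = suc x} z∈l x≤z with ∈-map⁻ suc z∈l
  ... | y , y∈ , refl = inj₁ (∈-map⁺ suc (∈-upTo⁺ (≤-<-trans (s≤s⁻¹ x≤z) (∈-upTo⁻ y∈))))

n-nonZero : ∀ g → NonZero (n g)
n-nonZero g = nonEmpty (Equivalence.from (Finite.complete (GenusFinite.finite g) (ordinary g))
  (trans (length-map suc (upTo g)) (length-upTo g)))
  where
  nonEmpty : ∀ {P : Pred NumericalSemigroup 0ℓ} {xs} → Any P xs → NonZero (length xs)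
  nonEmpty (here _)  = _
  nonEmpty (there _) = _

-- Rational ε suffice, since every positive real exceeds a positive rational.
_⟶_ : (ℕ → ℚ) → ℚ → Set
a ⟶ ℓ = ∀ ε → 0ℚ ℚ.< ε → ∃[ N ] (∀ k → N ≤ k → ℚ.∣ a k ℚ.- ℓ ∣ ℚ.< ε)

{-# OPTIONS --safe #-}

-- Let c, e, L be the invariants of S, of genus g, so that c ≤ 2g.  Both the
-- minimal generators of S and the elements of L determine S together with c,
-- since S = ⟨ X ⟩ ∪ [c, ∞) for either set X.  If e |L| < c ≤ s², then e < s or
-- |L| < s, so S is determined by at most s + 1 numbers below 4g + 2.  With s of
-- order √g this leaves at most (4g + 2)^(s + 1) = 2^O(√g log g) semigroups
-- that violate Wilf's inequality, whereas n_g ≥ 2^⌊g/3⌋.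
module Submission where

open import Data.Fin.Base using (Fin; zero; suc; toℕ; fromℕ<; combine; finToFun; funToFin)
open import Data.Fin.Properties
  using (toℕ<n; toℕ-injective; toℕ-fromℕ<; combine-injective; finToFun-funToFin;
         funToFin-finToFin; injective⇒≤)
open import Data.Integer.Base using (+_; +[1+_]; -[1+_])
import Data.Integer.Base as ℤ
import Data.Integer.Properties as ℤₚ
import Data.Integer.Tactic.RingSolver as ℤ-Solver
open import Data.List.Base
  using (List; []; _∷_; _++_; length; map; filter; lookup; tabulate; upTo)
open import Data.List.Extrema.Nat using (max≤v⁺)
open import Data.List.Membership.Propositional using (_∈_)
open import Data.List.Membership.Propositional.Properties
  using (∈-++⁺ˡ; ∈-++⁺ʳ; ∈-++⁻; ∈-map⁺; ∈-map⁻; ∈-filter⁺; ∈-filter⁻; ∈-upTo⁺; ∈-upTo⁻;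
         ∈-tabulate⁺; ∈-tabulate⁻; ∈-lookup)
import Data.List.Membership.Setoid.Properties as SetoidMembershipₚ
open import Data.List.Properties
  using (length-++; length-map; length-upTo; length-tabulate; tabulate-cong)
open import Data.List.Relation.Unary.All as All using (All; []; _∷_)
import Data.List.Relation.Unary.All.Properties as Allₚ
open import Data.List.Relation.Unary.AllPairs using (_∷_)
open import Data.List.Relation.Unary.Any as Any using (here; there)
import Data.List.Relation.Unary.Unique.Propositional.Properties as Uniqueₚ
import Data.List.Relation.Unary.Unique.Setoid as SetoidUnique
import Data.List.Relation.Unary.Unique.Setoid.Properties as SetoidUniqueₚ
open import Data.Nat.Base hiding (_/_)
open import Data.Nat.Properties
open import Data.Nat.Tactic.RingSolver using (solve-∀)
open import Data.Product.Base using (∃-syntax; _×_; _,_; proj₁; proj₂)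
open import Data.Rational.Base as ℚ using (ℚ; mkℚ; 0ℚ; 1ℚ; _/_; toℚᵘ)
import Data.Rational.Properties as ℚₚ
open import Data.Rational.Unnormalised.Base as ℚᵘ using (mkℚᵘ; 1ℚᵘ; *≡*; *<*)
import Data.Rational.Unnormalised.Properties as ℚᵘₚ
open import Data.Sum.Base using (_⊎_; inj₁; inj₂)
open import Data.Vec.Functional as Vec using ()
open import Function.Base using (_∘_)
open import Function.Bundles using (Equivalence)
open import Level using (Level)
open import Relation.Binary.Bundles using (Setoid)
open import Relation.Binary.PropositionalEquality
open import Relation.Nullary using (¬_; yes; no; ¬?; contradiction)
open import Relation.Unary using (Pred; Decidable; _≐_)

open import Defs
open NumericalSemigroup

private
  variable
    a ℓ p r : Level

-- Counting by codes, and padding lists to a fixed length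

module _ (A : Setoid a ℓ) where

  open Setoid A using (Carrier) renaming (_≈_ to _≈ₐ_)

  lookup-injective : ∀ {xs} → SetoidUnique.Unique A xs →
                     ∀ i j → lookup xs i ≈ₐ lookup xs j → i ≡ j
  lookup-injective (_ ∷ _)  zero    zero    _  = refl
  lookup-injective (x∉ ∷ _) zero    (suc j) eq = contradiction eq (All.lookup x∉ (∈-lookup j))
  lookup-injective (x∉ ∷ _) (suc i) zero    eq =
    contradiction (Setoid.sym A eq) (All.lookup x∉ (∈-lookup i))
  lookup-injective (_ ∷ u)  (suc i) (suc j) eq = cong suc (lookup-injective u i j eq)

  -- Choosing a code for each position of `xs` is injective: positions with the same code hold
  -- equivalent entries, hence coincide. As `R` is a relation, the chosen codes need not respect
  -- `_≈ₐ_`.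
  unique-coded⇒length≤ : ∀ {xs m} → SetoidUnique.Unique A xs → (R : Carrier → Fin m → Set r) →
                         (∀ {x y i} → R x i → R y i → x ≈ₐ y) →
                         (∀ {x} → x ∈ xs → ∃[ i ] R x i) → length xs ≤ m
  unique-coded⇒length≤ {xs = xs} u R R-inj code =
    injective⇒≤ {f = λ i → proj₁ (code (∈-lookup {xs = xs} i))} λ {i} {j} eq →
      lookup-injective u i j (R-inj (proj₂ (code (∈-lookup i)))
        (subst (R (lookup xs j)) (sym eq) (proj₂ (code (∈-lookup j)))))

length-filter-¬ : ∀ {A : Set a} {P : Pred A p} (P? : Decidable P) xs →
                  length xs ≡ length (filter P? xs) + length (filter (¬? ∘ P?) xs)
length-filter-¬ P? []       = refl
length-filter-¬ P? (x ∷ xs) with P? x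
... | yes _ = cong suc (length-filter-¬ P? xs)
... | no  _ = trans (cong suc (length-filter-¬ P? xs)) (sym (+-suc _ _))

-- The filler is 0, which lies in every submonoid, so padding leaves the generated set unchanged and
-- lets `Fin s → Fin b` code all lists of length at most `s`.
pad : ∀ {b s xs} → 0 < b → length xs ≤ s → All (_< b) xs →
      ∃[ f ] ((∀ {y} → y ∈ xs → y ∈ tabulate (toℕ ∘ f)) ×
              (∀ (i : Fin s) → toℕ {b} (f i) ∈ 0 ∷ xs))
pad 0<b _ [] = (λ _ → fromℕ< 0<b) , (λ ()) , λ _ → here (toℕ-fromℕ< 0<b)
pad {xs = x ∷ xs} 0<b (s≤s len) (x<b ∷ xs<b) with f , ⊇ , ⊆ ← pad 0<b len xs<b =
  fromℕ< x<b Vec.∷ f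
  , (λ { (here refl) → here (sym (toℕ-fromℕ< x<b)) ; (there y∈) → there (⊇ y∈) })
  , λ { zero → there (here (toℕ-fromℕ< x<b)) ; (suc i) → weaken (⊆ i) }
  where
  weaken : ∀ {y} → y ∈ 0 ∷ xs → y ∈ 0 ∷ x ∷ xs
  weaken (here eq)  = here eq
  weaken (there y∈) = there (there y∈)

-- Semigroups violating Wilf's inequality

⟨⟩-mono : ∀ {xs ys} → (∀ {x} → x ∈ xs → x ∈ ys) → ∀ {y} → ⟨ xs ⟩ y → ⟨ ys ⟩ y
⟨⟩-mono sub unit      = unit
⟨⟩-mono sub (gen x∈)  = gen (sub x∈)
⟨⟩-mono sub (add p q) = add (⟨⟩-mono sub p) (⟨⟩-mono sub q)

⟨⟩-least : ∀ S {xs} → (∀ {x} → x ∈ xs → Member S x) → ∀ {y} → ⟨ xs ⟩ y → Member S y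
⟨⟩-least S sub unit      = 0∈ S
⟨⟩-least S sub (gen x∈)  = sub x∈
⟨⟩-least S sub (add p q) = +-closed S (⟨⟩-least S sub p) (⟨⟩-least S sub q)

conductor≤2genus : ∀ S → conductor S ≤ genus S + genus S
conductor≤2genus S = max≤v⁺ z≤n (Allₚ.map⁺ (All.tabulate (gap<2genus S)))

Wilf? : Decidable Wilf
Wilf? S = conductor S ≤? embeddingDimension S * length (L S)

-- What the minimal generators and `L S` have in common. The bound on entries is that of
-- `atom<bound`.
GeneratesBelowConductor : NumericalSemigroup → List ℕ → Set
GeneratesBelowConductor S xs =
  (∀ {x} → x ∈ xs → Member S x × x < suc (conductor S) + suc (conductor S)) ×
  (∀ {y} → Member S y → y < conductor S → ⟨ xs ⟩ y)

atoms-generateBelow : ∀ S → GeneratesBelowConductor S (Atoms.atoms S)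
atoms-generateBelow S =
    (λ x∈ → let atom = proj₂ (∈-filter⁻ atom? {xs = upTo bound} x∈) in proj₁ atom , atom<bound atom)
  , λ y∈S _ → atoms-generate _ y∈S
  where open Atoms S

L-generatesBelow : ∀ S → GeneratesBelowConductor S (L S)
L-generatesBelow S =
    (λ x∈ → let x∈upTo , x∈S = ∈-filter⁻ (member? S) {xs = upTo (conductor S)} x∈
            in x∈S , ≤-trans (∈-upTo⁻ x∈upTo) (≤-trans (n≤1+n _) (m≤m+n _ _)))
  , λ y∈S y<c → gen (∈-filter⁺ (member? S) (∈-upTo⁺ y<c) y∈S)

-- `embeddingDimension S` is `length (Atoms.atoms S)` by definition. If both lengths exceeded `s`,
-- their product would be at least `s * s`, hence at least the conductor.
¬Wilf⇒few-generators : ∀ S {s} → conductor S ≤ s * s → ¬ Wilf S →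
                       ∃[ xs ] length xs ≤ s × GeneratesBelowConductor S xs
¬Wilf⇒few-generators S {s} c≤s² ¬W with length (Atoms.atoms S) ≤? s | length (L S) ≤? s
... | yes e≤s | _       = Atoms.atoms S , e≤s , atoms-generateBelow S
... | no  _   | yes l≤s = L S , l≤s , L-generatesBelow S
... | no  e≰s | no  l≰s =
  contradiction (≤-trans c≤s² (*-mono-≤ (<⇒≤ (≰⇒> e≰s)) (<⇒≤ (≰⇒> l≰s)))) ¬W

module _ {b s : ℕ} where

  -- Entry `zero` stores the conductor, the other `s` entries the padded generators.
  Decode : (Fin (suc s) → Fin b) → Pred ℕ _
  Decode f y = ⟨ tabulate (toℕ ∘ f ∘ suc) ⟩ y ⊎ toℕ (f zero) ≤ y

  -- Needed because passing through `funToFin` returns the coding function only up to pointwise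
  -- equality.
  Decode-cong : ∀ {f f′} → (∀ i → f i ≡ f′ i) → ∀ {y} → Decode f y → Decode f′ y
  Decode-cong eq {y} (inj₁ p) =
    inj₁ (subst (λ xs → ⟨ xs ⟩ y) (tabulate-cong (cong toℕ ∘ eq ∘ suc)) p)
  Decode-cong eq {y} (inj₂ q) = inj₂ (subst (λ i → toℕ i ≤ y) (eq zero) q)

  encode : ∀ S → suc (conductor S) + suc (conductor S) ≤ b →
           ∀ {xs} → length xs ≤ s → GeneratesBelowConductor S xs →
           ∃[ f ] Member S ≐ Decode f
  encode S bound {xs} len (small , generates)
    with f , ⊇ , ⊆ ← pad (≤-trans z<s bound) len
                         (All.tabulate λ x∈ → <-≤-trans (proj₂ (small x∈)) bound) =
    fromℕ< c<b Vec.∷ f , to , from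
    where
    c<b : conductor S < b
    c<b = ≤-trans (m≤m+n _ _) bound

    to : ∀ {y} → Member S y → Decode (fromℕ< c<b Vec.∷ f) y
    to {y} y∈S with y <? conductor S
    ... | yes y<c = inj₁ (⟨⟩-mono ⊇ (generates y∈S y<c))
    ... | no  y≮c = inj₂ (subst (_≤ y) (sym (toℕ-fromℕ< c<b)) (≮⇒≥ y≮c))

    entry∈S : ∀ {x} → x ∈ 0 ∷ xs → Member S x
    entry∈S (here refl) = 0∈ S
    entry∈S (there x∈)  = proj₁ (small x∈)

    from : ∀ {y} → Decode (fromℕ< c<b Vec.∷ f) y → Member S y
    from (inj₁ p) = ⟨⟩-least S (λ x∈ → let i , eq = ∈-tabulate⁻ x∈
                                       in subst (Member S) (sym eq) (entry∈S (⊆ i))) p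
    from {y} (inj₂ q) = ≥conductor⇒member S (subst (_≤ y) (toℕ-fromℕ< c<b) q)

  Codes : NumericalSemigroup → Fin (b ^ suc s) → Set
  Codes S i = Member S ≐ Decode (finToFun {b} {suc s} i)

  Codes-injective : ∀ {S T i} → Codes S i → Codes T i → S ≈ T
  Codes-injective (p , p′) (q , q′) = q′ ∘ p , p′ ∘ q

  code : ∀ S → suc (conductor S) + suc (conductor S) ≤ b → conductor S ≤ s * s → ¬ Wilf S →
         ∃[ i ] Codes S i
  code S bound c≤s² ¬W with xs , len , G ← ¬Wilf⇒few-generators S {s} c≤s² ¬W
                       with f , to , from ← encode S bound len G =
    funToFin f
    , Decode-cong (sym ∘ finToFun-funToFin f) ∘ to
    , from ∘ Decode-cong (finToFun-funToFin f)

nonWilf : ℕ → List NumericalSemigroup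
nonWilf g = filter (¬? ∘ Wilf?) (GenusFinite.semigroups g)

-- `w g` unfolds to the length of a filter whose test has the same body as `Wilf?`.
n≡w+nonWilf : ∀ g → n g ≡ w g + length (nonWilf g)
n≡w+nonWilf g = length-filter-¬ Wilf? (GenusFinite.semigroups g)

∈-semigroups⁻ : ∀ {g S} → S ∈ GenusFinite.semigroups g → genus S ≡ g
∈-semigroups⁻ {g} {S} S∈ = Equivalence.to (Finite.complete (GenusFinite.finite g) S)
  (Any.map (λ { refl → Setoid.refl NumericalSemigroup-setoid {S} }) S∈)

-- By `conductor≤2genus`, the single base `2(2g + 1)` exceeds all entries of the codes of all these
-- semigroups.
nonWilf≤ : ∀ g s → g + g ≤ s * s → length (nonWilf g) ≤ (suc (g + g) + suc (g + g)) ^ suc s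
nonWilf≤ g s 2g≤s² = unique-coded⇒length≤ NumericalSemigroup-setoid
  (SetoidUniqueₚ.filter⁺ NumericalSemigroup-setoid (¬? ∘ Wilf?)
    (Finite.unique (GenusFinite.finite g)))
  (Codes {b} {s})
  (λ {S} {T} {i} → Codes-injective {b} {s} {S} {T} {i})
  λ {S} S∈ →
    let S∈g , ¬W = ∈-filter⁻ (¬? ∘ Wilf?) {xs = GenusFinite.semigroups g} S∈
        c≤2g     = subst (λ h → conductor S ≤ h + h) (∈-semigroups⁻ {g} {S} S∈g)
                     (conductor≤2genus S)
    in code {b} {s} S (+-mono-≤ (s≤s c≤2g) (s≤s c≤2g)) (≤-trans c≤2g 2g≤s²) ¬W
  where
  b = suc (g + g) + suc (g + g)

-- Exponentially many semigroups of each genus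

-- The multiplicity is m = suc a; above it, exactly one of m + 2i and m + 2i + 1
-- is a gap for each i < k.  A sum of two nonzero elements is at least 2m, beyond
-- all gaps.
module PairGaps (a k : ℕ) (2k≤m : k * 2 ≤ suc a) where

  -- The value of `combine i (b i)` is `2i + b i`: the bit `b i` selects the gap in the `i`-th pair.
  highGap : (Fin k → Fin 2) → Fin k → ℕ
  highGap b i = suc a + toℕ (combine i (b i))

  gapList : (Fin k → Fin 2) → List ℕ
  gapList b = map suc (upTo a) ++ tabulate (highGap b)

  low∈ : ∀ b {x} → x ≢ 0 → x < suc a → x ∈ gapList b
  low∈ b {zero}  x≢0 _         = contradiction refl x≢0
  low∈ b {suc x} _   (s≤s x<a) = ∈-++⁺ˡ (∈-map⁺ suc (∈-upTo⁺ x<a))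

  low⁻ : ∀ {x} → x ∈ map suc (upTo a) → x ≢ 0 × x < suc a
  low⁻ x∈ with _ , y∈ , refl ← ∈-map⁻ suc x∈ = (λ ()) , s≤s (∈-upTo⁻ y∈)

  high⁻ : ∀ b {x} → x ∈ tabulate (highGap b) → suc a ≤ x × x < suc a + suc a
  high⁻ b x∈ with i , refl ← ∈-tabulate⁻ x∈ =
    -- `combine i (b i)` lies in `Fin (k * 2)`, and `k * 2 ≤ suc a` keeps the gap below `2m`.
    m≤m+n _ _ , +-monoʳ-< (suc a) (<-≤-trans (toℕ<n (combine i (b i))) 2k≤m)

  gapList⁻ : ∀ b {x} → x ∈ gapList b → x ≢ 0 × x < suc a + suc a
  gapList⁻ b x∈ with ∈-++⁻ (map suc (upTo a)) x∈
  ... | inj₁ x∈low  = let x≢0 , x<m = low⁻ x∈low in x≢0 , ≤-trans x<m (m≤m+n _ _)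
  ... | inj₂ x∈high =
    let m≤x , x<2m = high⁻ b x∈high in (λ { refl → contradiction m≤x λ () }) , x<2m

  highGap-injective : ∀ {b b′ i j} → highGap b i ≡ highGap b′ j → i ≡ j × b i ≡ b′ j
  highGap-injective {b} {b′} {i} {j} eq =
    combine-injective i (b i) j (b′ j) (toℕ-injective (+-cancelˡ-≡ (suc a) _ _ eq))

  isGapSet : ∀ b → IsGapSet (gapList b)
  isGapSet b =
      Uniqueₚ.++⁺ (Uniqueₚ.map⁺ suc-injective (Uniqueₚ.upTo⁺ a))
        (Uniqueₚ.tabulate⁺ (proj₁ ∘ highGap-injective {b} {b}))
        (λ (x∈low , x∈high) → <⇒≱ (proj₂ (low⁻ x∈low)) (proj₁ (high⁻ b x∈high)))
    , (λ 0∈ → proj₁ (gapList⁻ b 0∈) refl)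
    , All.tabulate λ z∈ → All.tabulate λ x∈ → split z∈ (s≤s⁻¹ (∈-upTo⁻ x∈))
    where
    split : ∀ {z x} → z ∈ gapList b → x ≤ z → x ∈ gapList b ⊎ z ∸ x ∈ gapList b
    split {z} {x} z∈ x≤z with x ≟ 0 | z ∸ x ≟ 0 | x <? suc a | z ∸ x <? suc a
    ... | yes refl | _       | _       | _       = inj₂ z∈
    ... | no _     | yes eq  | _       | _       =
      inj₁ (subst (_∈ gapList b) (≤-antisym (m∸n≡0⇒m≤n eq) x≤z) z∈)
    ... | no x≢0   | no _    | yes x<m | _       = inj₁ (low∈ b x≢0 x<m)
    ... | no _     | no y≢0  | no _    | yes y<m = inj₂ (low∈ b y≢0 y<m)
    ... | no _     | no _    | no x≮m  | no y≮m  =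
      contradiction (subst (suc a + suc a ≤_) (m+[n∸m]≡n x≤z) (+-mono-≤ (≮⇒≥ x≮m) (≮⇒≥ y≮m)))
                    (<⇒≱ (proj₂ (gapList⁻ b z∈)))

  semigroup : (Fin k → Fin 2) → NumericalSemigroup
  semigroup b = fromGaps (gapList b) (isGapSet b)

  genus≡ : ∀ b → genus (semigroup b) ≡ a + k
  genus≡ b = begin
    length (gapList b)                                           ≡⟨ length-++ (map suc (upTo a)) ⟩
    length (map suc (upTo a)) + length (tabulate (highGap b))
      ≡⟨ cong₂ _+_ (trans (length-map suc (upTo a)) (length-upTo a)) (length-tabulate (highGap b)) ⟩
    a + k                                                        ∎
    where open ≡-Reasoning

  -- The gap `highGap b i` is at least `m`, so in the other semigroup it is some `highGap b′ j`;
  -- injectivity of `combine` then gives `i ≡ j` and equal bits.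
  semigroup-injective : ∀ {b b′} → semigroup b ≈ semigroup b′ → ∀ i → b i ≡ b′ i
  semigroup-injective {b} {b′} eq i
    with ∈-++⁻ (map suc (upTo a)) {ys = tabulate (highGap b′)}
           (gaps-⊆ {semigroup b} {semigroup b′} eq
             (∈-++⁺ʳ (map suc (upTo a)) (∈-tabulate⁺ {f = highGap b} i)))
  ... | inj₁ x∈low = contradiction (m≤m+n (suc a) _) (<⇒≱ (proj₂ (low⁻ x∈low)))
  ... | inj₂ x∈high with j , eq′ ← ∈-tabulate⁻ x∈high
                    with refl , bi≡ ← highGap-injective {b} {b′} {i} {j} eq′ = bi≡

funToFin-cong : ∀ {m b} {f f′ : Fin m → Fin b} → (∀ i → f i ≡ f′ i) → funToFin f ≡ funToFin f′
funToFin-cong {zero}  eq = refl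
funToFin-cong {suc m} eq = cong₂ combine (eq zero) (funToFin-cong (eq ∘ suc))

-- Each bit vector is sent to the index of its semigroup in the enumeration; equal indices give
-- equivalent semigroups, hence equal bits.
2^k≤n[a+k] : ∀ a k → k * 2 ≤ suc a → 2 ^ k ≤ n (a + k)
2^k≤n[a+k] a k 2k≤m = injective⇒≤ {f = λ i → Any.index (listed i)} λ {i} {j} eq → begin
  i                             ≡⟨ funToFin-finToFin {k} i ⟨
  funToFin (finToFun {2} {k} i) ≡⟨ funToFin-cong (semigroup-injective (same i j eq)) ⟩
  funToFin (finToFun {2} {k} j) ≡⟨ funToFin-finToFin {k} j ⟩
  j                             ∎
  where
  open ≡-Reasoning
  open PairGaps a k 2k≤m

  S : Fin (2 ^ k) → NumericalSemigroup
  S i = semigroup (finToFun i)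

  listed : ∀ i → Any.Any (S i ≈_) (GenusFinite.semigroups (a + k))
  listed i = Equivalence.from (Finite.complete (GenusFinite.finite (a + k)) (S i))
    (genus≡ (finToFun i))

  same : ∀ i j → Any.index (listed i) ≡ Any.index (listed j) → S i ≈ S j
  same i j = SetoidMembershipₚ.index-injective NumericalSemigroup-setoid
    {x₁ = S i} {x₂ = S j} (listed i) (listed j)

-- Take `a = g ∸ k`: then `3 * k ≤ g` yields `k * 2 ≤ a`.
2^k≤n : ∀ {g k} → 3 * k ≤ g → 2 ^ k ≤ n g
2^k≤n {g} {k} 3k≤g = subst (λ h → 2 ^ k ≤ n h) (m∸n+n≡m (≤-trans (m≤n*m k 3) 3k≤g))
  (2^k≤n[a+k] (g ∸ k) k (m≤n⇒m≤1+n (m+n≤o⇒m≤o∸n (k * 2) (subst (_≤ g) (3k≡ k) 3k≤g))))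
  where
  3k≡ : ∀ k → 3 * k ≡ k * 2 + k
  3k≡ = solve-∀

-- Comparison of the two growth rates

n<2^n : ∀ m → m < 2 ^ m
n<2^n zero    = z<s
n<2^n (suc m) = begin
  suc (suc m)           ≤⟨ +-mono-≤ (≤-trans z<s (n<2^n m)) (n<2^n m) ⟩
  2 ^ m + 2 ^ m         ≡⟨ cong (_+_ (2 ^ m)) (+-identityʳ (2 ^ m)) ⟨
  2 ^ suc m             ∎
  where open ≤-Reasoning

-- Here `2 ^ h` stands in for the square root, up to a factor 2, and `h` for half the binary
-- logarithm. The `suc` excludes 0, which has no such bracket.
4^-bracket : ∀ g → ∃[ h ] (2 ^ h * 2 ^ h ≤ suc g × suc g < 2 ^ suc h * 2 ^ suc h)
4^-bracket zero    = 0 , ≤-refl , s≤s (s≤s z≤n)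
4^-bracket (suc g) with h , lo , hi ← 4^-bracket g with suc (suc g) <? 2 ^ suc h * 2 ^ suc h
... | yes hi′ = h , m≤n⇒m≤1+n lo , hi′
... | no  lo′ = suc h , ≮⇒≥ lo′ , (begin-strict
  suc (suc g)                       ≤⟨ hi ⟩
  2 ^ suc h * 2 ^ suc h             <⟨ *-mono-< x<2x x<2x ⟩
  2 ^ suc (suc h) * 2 ^ suc (suc h) ∎)
  where
  open ≤-Reasoning
  x<2x : 2 ^ suc h < 2 ^ suc (suc h)
  x<2x = ^-monoʳ-< 2 (s≤s (s≤s z≤n)) (n<1+n (suc h))

-- The factor 33 arises in the proof of `3k≤g` below. The bound splits as `33 ≤ 2 ^ 6` and
-- `12 + m ≤ 2 ^ (4 + m)`.
33[2+h]≤2^h : ∀ m → let h = 10 + m in 33 * (2 + h) ≤ 2 ^ h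
33[2+h]≤2^h m = begin
  33 * (12 + m)              ≤⟨ *-mono-≤ (m≤m+n 33 31) 12+m≤2^[4+m] ⟩
  2 ^ 6 * 2 ^ (4 + m)        ≡⟨ ^-distribˡ-+-* 2 6 (4 + m) ⟨
  2 ^ (10 + m)               ∎
  where
  open ≤-Reasoning
  12+m≤2^[4+m] : 12 + m ≤ 2 ^ (4 + m)
  12+m≤2^[4+m] = begin
    12 + m                     ≤⟨ +-mono-≤ (m≤m+n 12 4) (m≤n*m m 16) ⟩
    16 + 16 * m                ≡⟨ *-suc 16 m ⟨
    16 * suc m                 ≤⟨ *-monoʳ-≤ 16 (n<2^n m) ⟩
    2 ^ 4 * 2 ^ m              ≡⟨ ^-distribˡ-+-* 2 4 m ⟨
    2 ^ (4 + m)                ∎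

-- The witnesses are s = 4x and k = q + E, where (4g + 2)^(s + 1) ≤ 2^E.
growth-at : ∀ q g h x → x ≡ 2 ^ h → q ≤ h → 33 * (2 + h) ≤ x →
            x * x ≤ g → g < (2 * x) * (2 * x) → ∃[ s ] ∃[ k ]
            (g + g ≤ s * s × 3 * k ≤ g × q * (suc (g + g) + suc (g + g)) ^ suc s < 2 ^ k)
growth-at q g h x x≡2^h q≤h 33[2+h]≤x x²≤g g<4x² = 4 * x , q + E , 2g≤s² , 3k≤g , small
  where
  open ≤-Reasoning
  -- The first factor bounds the binary logarithm of `B`, since `4(g + 1) ≤ 16x²` and `4x` is
  -- `2 ^ (2 + h)`; the second is the exponent `s + 1`.
  E = (2 + h + (2 + h)) * suc (4 * x)
  B = suc (g + g) + suc (g + g)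

  1≤x : 1 ≤ x
  1≤x = subst (1 ≤_) (sym x≡2^h) (m^n>0 2 h)

  2g≤s² : g + g ≤ (4 * x) * (4 * x)
  2g≤s² = begin
    g + g                                                ≤⟨ +-mono-≤ (<⇒≤ g<4x²) (<⇒≤ g<4x²) ⟩
    (2 * x) * (2 * x) + (2 * x) * (2 * x)                ≤⟨ m≤m+n _ _ ⟩
    (2 * x) * (2 * x) + (2 * x) * (2 * x) + 8 * (x * x)  ≡⟨ identity x ⟩
    (4 * x) * (4 * x)                                    ∎
    where
    identity : ∀ y → (2 * y) * (2 * y) + (2 * y) * (2 * y) + 8 * (y * y) ≡ (4 * y) * (4 * y)
    identity = solve-∀

  3k≤g : 3 * (q + E) ≤ g
  3k≤g = begin
    3 * (q + E)
      -- With `j = 2 + h`, the bounds `q ≤ jx` and `1 + 4x ≤ 5x` give `3(jx + 10jx) = 33jx`.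
      ≤⟨ *-monoʳ-≤ 3 (+-mono-≤ (≤-trans q≤h (≤-trans (m≤n+m h 2) (m≤m*n (2 + h) x {{>-nonZero 1≤x}})))
           (*-monoʳ-≤ (2 + h + (2 + h)) (+-monoˡ-≤ (4 * x) 1≤x))) ⟩
    3 * ((2 + h) * x + (2 + h + (2 + h)) * (x + 4 * x))   ≡⟨ identity (2 + h) x ⟩
    33 * (2 + h) * x                                      ≤⟨ *-monoˡ-≤ x 33[2+h]≤x ⟩
    x * x                                                 ≤⟨ x²≤g ⟩
    g                                                     ∎
    where
    identity : ∀ j x → 3 * (j * x + (j + j) * (x + 4 * x)) ≡ 33 * j * x
    identity = solve-∀

  B≤ : B ≤ 2 ^ (2 + h + (2 + h))
  B≤ = begin
    B                                 ≤⟨ m≤m+n B 2 ⟩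
    B + 2                             ≡⟨ identity₁ g ⟩
    4 * suc g                         ≤⟨ *-monoʳ-≤ 4 g<4x² ⟩
    4 * ((2 * x) * (2 * x))           ≡⟨ identity₂ x ⟩
    (2 * (2 * x)) * (2 * (2 * x))     ≡⟨ cong (λ y → (2 * (2 * y)) * (2 * (2 * y))) x≡2^h ⟩
    2 ^ (2 + h) * 2 ^ (2 + h)         ≡⟨ ^-distribˡ-+-* 2 (2 + h) (2 + h) ⟨
    2 ^ (2 + h + (2 + h))             ∎
    where
    identity₁ : ∀ g → suc (g + g) + suc (g + g) + 2 ≡ 4 * suc g
    identity₁ = solve-∀
    identity₂ : ∀ y → 4 * ((2 * y) * (2 * y)) ≡ (2 * (2 * y)) * (2 * (2 * y))
    identity₂ = solve-∀

  small : q * B ^ suc (4 * x) < 2 ^ (q + E)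
  small = begin-strict
    q * B ^ suc (4 * x)                            ≤⟨ *-monoʳ-≤ q (^-monoˡ-≤ (suc (4 * x)) B≤) ⟩
    q * (2 ^ (2 + h + (2 + h))) ^ suc (4 * x)      ≡⟨ cong (q *_) (^-*-assoc 2 (2 + h + (2 + h)) (suc (4 * x))) ⟩
    -- The summand `q` of `k` absorbs the factor `q` and makes the inequality strict.
    q * 2 ^ E                                      <⟨ *-monoˡ-< (2 ^ E) {{m^n≢0 2 E}} (n<2^n q) ⟩
    2 ^ q * 2 ^ E                                  ≡⟨ ^-distribˡ-+-* 2 q E ⟨
    2 ^ (q + E)                                    ∎

growth : ∀ q → ∃[ N ] (∀ g → N ≤ g → ∃[ s ] ∃[ k ]
  (g + g ≤ s * s × 3 * k ≤ g × q * (suc (g + g) + suc (g + g)) ^ suc s < 2 ^ k))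
growth q = suc (y * y) , bounds
  where
  -- Beyond `y * y` the bracket has `h ≥ 10 + q`: the 10 serves `33[2+h]≤2^h`, the `q` serves
  -- `q ≤ h`.
  y = 2 ^ (10 + q)

  bounds : ∀ g → suc (y * y) ≤ g → ∃[ s ] ∃[ k ]
    (g + g ≤ s * s × 3 * k ≤ g × q * (suc (g + g) + suc (g + g)) ^ suc s < 2 ^ k)
  bounds (suc g) y²<g with h , x²≤g , g<4x² ← 4^-bracket g =
    growth-at q (suc g) h (2 ^ h) refl (m+n≤o⇒n≤o 10 10+q≤h) 33[2+h]≤x x²≤g g<4x²
    where
    10+q≤h : 10 + q ≤ h
    10+q≤h = ≮⇒≥ λ h<10+q →
      let 2x≤y = ^-monoʳ-≤ 2 h<10+q
      in <-asym (<-≤-trans g<4x² (*-mono-≤ 2x≤y 2x≤y)) y²<g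

    33[2+h]≤x : 33 * (2 + h) ≤ 2 ^ h
    33[2+h]≤x = subst (λ i → 33 * (2 + i) ≤ 2 ^ i) (m+[n∸m]≡n (m+n≤o⇒m≤o 10 10+q≤h))
                      (33[2+h]≤2^h (h ∸ 10))

-- The limit

-- The distance is `v/m`, and a positive `ε` is at least the reciprocal of its denominator.
-- Unnormalised rationals make both facts integer identities or inequalities after
-- cross-multiplication.
∣u/m-1∣<ε : ∀ ε → 0ℚ ℚ.< ε → ∀ {u v m} .{{_ : NonZero m}} → m ≡ u + v →
            ℚ.↧ₙ ε * v < m → ℚ.∣ + u / m ℚ.- 1ℚ ∣ ℚ.< ε
∣u/m-1∣<ε ε@(mkℚ +[1+ c ] d _) 0<ε {u} {v} {m@(suc m-1)} m≡u+v dv<m = ℚₚ.toℚᵘ-cancel-< (begin-strict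
  toℚᵘ ℚ.∣ + u / m ℚ.- 1ℚ ∣              ≃⟨ ℚₚ.toℚᵘ-homo-∣-∣ (+ u / m ℚ.- 1ℚ) ⟩
  ℚᵘ.∣ toℚᵘ (+ u / m ℚ.- 1ℚ) ∣           ≃⟨ ℚᵘₚ.∣-∣-cong (ℚₚ.toℚᵘ-homo-+ (+ u / m) (ℚ.- 1ℚ)) ⟩
  ℚᵘ.∣ toℚᵘ (+ u / m) ℚᵘ.- 1ℚᵘ ∣
    ≃⟨ ℚᵘₚ.∣-∣-cong (ℚᵘₚ.+-congˡ (ℚᵘ.- 1ℚᵘ) (ℚₚ.toℚᵘ-fromℚᵘ (mkℚᵘ (+ u) m-1))) ⟩
  ℚᵘ.∣ mkℚᵘ (+ u) m-1 ℚᵘ.- 1ℚᵘ ∣         ≃⟨ ℚᵘₚ.∣-∣-cong difference ⟩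
  ℚᵘ.∣ ℚᵘ.- mkℚᵘ (+ v) m-1 ∣             ≡⟨ ℚᵘₚ.∣-p∣≡∣p∣ (mkℚᵘ (+ v) m-1) ⟩
  mkℚᵘ (+ v) m-1                         <⟨ *<* cross ⟩
  toℚᵘ ε                                 ∎)
  where
  open ℚᵘₚ.≤-Reasoning

  identity : ∀ x y → (x ℤ.* ℤ.1ℤ ℤ.+ ℤ.-1ℤ ℤ.* (x ℤ.+ y)) ℤ.* (x ℤ.+ y) ≡
                     (ℤ.- y) ℤ.* ((x ℤ.+ y) ℤ.* ℤ.1ℤ)
  identity = ℤ-Solver.solve-∀

  difference : mkℚᵘ (+ u) m-1 ℚᵘ.- 1ℚᵘ ℚᵘ.≃ ℚᵘ.- mkℚᵘ (+ v) m-1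
  difference = *≡* (trans
    (subst (λ z → (+ u ℤ.* ℤ.1ℤ ℤ.+ ℤ.-1ℤ ℤ.* z) ℤ.* z ≡ (ℤ.- + v) ℤ.* (z ℤ.* ℤ.1ℤ))
      (cong +_ (sym m≡u+v)) (identity (+ u) (+ v)))
    (cong ((ℤ.- + v) ℤ.*_) (ℤₚ.pos-* m 1)))

  cross : + v ℤ.* + suc d ℤ.< +[1+ c ] ℤ.* + m
  cross = subst₂ ℤ._<_ (ℤₚ.pos-* v (suc d)) (ℤₚ.pos-* (suc c) m)
    -- The numerator `suc c` of `ε` is bounded below by 1.
    (ℤ.+<+ (<-≤-trans (subst (_< m) (*-comm (suc d) v) dv<m) (m≤n*m m (suc c))))
∣u/m-1∣<ε (mkℚ (+ 0) _ _)    (ℚ.*<* (ℤ.+<+ ()))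
∣u/m-1∣<ε (mkℚ -[1+ _ ] _ _) (ℚ.*<* ())

-- With `d` the denominator of `ε`, `d` times the number of violating semigroups is at most
-- `d * (4g + 2) ^ (s + 1)`, which is below `2 ^ k` and so below `n g`.
w/n⟶1-at : ∀ ε → 0ℚ ℚ.< ε → ∀ g →
           (∃[ s ] ∃[ k ] (g + g ≤ s * s × 3 * k ≤ g ×
              ℚ.↧ₙ ε * (suc (g + g) + suc (g + g)) ^ suc s < 2 ^ k)) →
           ℚ.∣ _/_ (+ w g) (n g) {{n-nonZero g}} ℚ.- 1ℚ ∣ ℚ.< ε
w/n⟶1-at ε 0<ε g (s , k , 2g≤s² , 3k≤g , small) =
  ∣u/m-1∣<ε ε 0<ε {w g} {length (nonWilf g)} {n g} {{n-nonZero g}} (n≡w+nonWilf g)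
    (<-≤-trans (≤-<-trans (*-monoʳ-≤ (ℚ.↧ₙ ε) (nonWilf≤ g s 2g≤s²)) small)
               (2^k≤n {g} {k} 3k≤g))

mainTheorem2 : (λ g → _/_ (+ w g) (n g) {{n-nonZero g}}) ⟶ 1ℚ
mainTheorem2 ε 0<ε = proj₁ (growth (ℚ.↧ₙ ε)) ,
  λ g N≤g → w/n⟶1-at ε 0<ε g (proj₂ (growth (ℚ.↧ₙ ε)) g N≤g)
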